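{- Let $f:\mathbb{N}\to\mathbb{Z}$ be a function with Newton representation $f(x)=\sum_{k\in\mathbb{N}} a_k\binom{x}{k}$ for all $x\in\mathbb{N}$, where $(a_k)_{k\in\mathbb{N}}$ is a sequence of integers. The following conditions are equivalent: (i) $f$ has integral difference ratios, i.e. $\dfrac{f(a)-f(b)}{a-b}\in\mathbb{Z}$ for all $a,b\in\mathbb{N}$ with $a\neq b$; (ii) $\mathrm{lcm}(k)$ divides $a_k$ for all $k\in\mathbb{N}$.
   Context: $\mathbb{N}$ denotes the non-negative integers. For $k\geq 1$, $\mathrm{lcm}(k)$ denotes the least common multiple of all positive integers less than or equal to $k$; by convention $\mathrm{lcm}(0)=1$. Since $\binom{x}{k}=0$ for $k>x$, the series $\sum_{k\in\mathbb{N}} a_k\binom{x}{k}$ is a finite sum for every $x\in\mathbb{N}$. Every $f:\mathbb{N}\to\mathbb{Z}$ has a unique Newton representation of this form, with integer coefficients $a_k=\sum_{i=0}^{k}(-1)^{k-i}f(i)\binom{k}{i}$. -}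

module Defs where

open import Data.Fin.Base using (toℕ)
open import Data.Integer.Base as ℤ using (ℤ; +_; 0ℤ)
import Data.Integer.Properties as ℤ
open import Data.List.Base using (foldr; applyDownFrom)
open import Data.Nat.Base using (ℕ; suc)
open import Data.Nat.Combinatorics using (_C_)
import Data.Nat.LCM as LCM
open import Data.Product.Base using (∃-syntax)
open import Data.Rational.Base as ℚ using (ℚ; 0ℚ; _/_; _÷_)
open import Data.Rational.Properties using (/-injective-≃)
open import Data.Rational.Unnormalised.Base using (mkℚᵘ)
open import Data.Rational.Unnormalised.Properties using (drop-*≡*)
open import Relation.Binary.PropositionalEquality
  using (_≡_; _≢_; sym; trans)

-- lcm of the list k, …, 2, 1; the empty list gives lcm 0 ≡ 1.
lcm : ℕ → ℕ
lcm k = foldr LCM.lcm 1 (applyDownFrom suc k)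

-- The series Σ a_k (x choose k), cut off at k = x: x C k is 0 for k > x.
newton : (ℕ → ℤ) → ℕ → ℤ
newton a x = ∑[ k ≤ x ] (a (toℕ k) ℤ.* + (x C toℕ k))
  where open import Algebra.Properties.Semiring.Sum ℤ.+-*-semiring

fromℤ : ℤ → ℚ
fromℤ i = i / 1

IsIntegral : ℚ → Set
IsIntegral q = ∃[ i ] q ≡ fromℤ i

fromℤ-nonZero : ∀ {a b} → a ≢ b → ℚ.NonZero (fromℤ (+ a ℤ.- + b))
fromℤ-nonZero {a} {b} a≢b = ℚ.≢-nonZero λ eq →
  a≢b (ℤ.+-injective (ℤ.i-j≡0⇒i≡j (+ a) (+ b) (fromℤ-≡0 eq)))
  where
  fromℤ-≡0 : ∀ {i} → fromℤ i ≡ 0ℚ → i ≡ 0ℤ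
  fromℤ-≡0 {i} eq = trans (sym (ℤ.*-identityʳ i))
    (drop-*≡* (/-injective-≃ (mkℚᵘ i 0) (mkℚᵘ 0ℤ 0) eq))

differenceRatio : (ℕ → ℤ) → (a b : ℕ) → a ≢ b → ℚ
differenceRatio f a b a≢b = fromℤ (f a ℤ.- f b) ÷ fromℤ (+ a ℤ.- + b)
  where instance _ = fromℤ-nonZero a≢b

HasIntegralDifferenceRatios : (ℕ → ℤ) → Set
HasIntegralDifferenceRatios f =
  ∀ a b (a≢b : a ≢ b) → IsIntegral (differenceRatio f a b a≢b)

{-# OPTIONS --safe #-}
-- Write E for the operator (E a)ₖ = aₖ + aₖ₊₁ on sequences. By Pascal's rule,
-- if a is the sequence of Newton coefficients of f, then Eˣ a is that of
-- n ↦ f (x + n), so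
--   f (x + n) - f x = Σ_{1 ≤ k ≤ n} (Eˣ a)ₖ (n choose k).
-- Since k (n choose k) = n (n-1 choose k-1), the k-th term is divisible by n as
-- soon as k ∣ (Eˣ a)ₖ. Isolating the term k = n, induction on n shows that f has
-- integral difference ratios iff k ∣ (Eˣ a)ₖ for all x and all k ≥ 1. As
-- (Eˣ a)ⱼ₊₁ = (Eˣ⁺¹ a)ⱼ - (Eˣ a)ⱼ, this spreads to k ∣ (Eˣ a)ⱼ for all j ≥ k ≥ 1,
-- that is, to lcm(j) ∣ (Eˣ a)ⱼ; and the condition lcm(j) ∣ aⱼ is stable under E.
module Submission where

open import Defs
open import Data.Fin.Base using (Fin; zero; suc; toℕ; fromℕ; inject₁)
open import Data.Fin.Properties using (toℕ-inject₁; toℕ-fromℕ; toℕ<n)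
open import Data.Integer.Base as ℤ using (ℤ; +_; 0ℤ)
open import Data.Integer.Divisibility.Signed
  using (_∣_; divides; ∣ᵤ⇒∣; ∣⇒∣ᵤ; ∣-trans; ∣m∣n⇒∣m+n; ∣m+n∣m⇒∣n)
import Data.Integer.Properties as ℤ
open import Data.Integer.Tactic.RingSolver using (solve-∀)
open import Data.Nat.Base as ℕ using (ℕ; zero; suc; s<s)
open import Data.Nat.Combinatorics
  using (_C_; nCn≡1; nCk≡nC[n∸k]; k>n⇒nCk≡0; nCk+nC[k+1]≡[n+1]C[k+1])
import Data.Nat.Divisibility as ℕ
open import Data.Nat.GeneralisedArithmetic using (fold)
open import Data.Nat.Induction using (<-rec)
import Data.Nat.LCM as LCM
import Data.Nat.Properties as ℕ
import Data.Nat.Tactic.RingSolver as ℕ-Solver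
open import Data.Product.Base using (_,_)
open import Data.Rational.Base as ℚ using (1ℚ)
import Data.Rational.Properties as ℚ
open import Data.Rational.Unnormalised.Base as ℚᵘ using (mkℚᵘ)
import Data.Rational.Unnormalised.Properties as ℚᵘ
open import Function.Base using (_∘_)
open import Function.Bundles using (_⇔_; mk⇔)
open import Relation.Binary.Consequences using (wlog)
open import Relation.Binary.PropositionalEquality
  using (_≡_; _≢_; refl; sym; trans; cong; cong₂; subst; subst₂; module ≡-Reasoning)
open import Algebra.Properties.Semiring.Sum ℤ.+-*-semiring
  using (sum; sum-cong-≗; sum-init-last; ∑-distrib-+; sum⁺-syntax)

-- Integrality of difference ratios as divisibility

fromℤ-injective : ∀ {i j} → fromℤ i ≡ fromℤ j → i ≡ j
fromℤ-injective {i} {j} eq = begin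
  i          ≡⟨ ℤ.*-identityʳ i ⟨
  i ℤ.* + 1  ≡⟨ ℚᵘ.drop-*≡* (ℚ.fromℚᵘ-injective {mkℚᵘ i 0} {mkℚᵘ j 0} eq) ⟩
  j ℤ.* + 1  ≡⟨ ℤ.*-identityʳ j ⟩
  j          ∎
  where open ≡-Reasoning

-- Rationals are kept in lowest terms, so the comparison is made among unnormalised fractions, where
-- the two denominators 1 multiply to 1 by computation.
fromℤ-homo-* : ∀ i j → fromℤ (i ℤ.* j) ≡ fromℤ i ℚ.* fromℤ j
fromℤ-homo-* i j = ℚ.toℚᵘ-injective (begin
  ℚ.toℚᵘ (fromℤ (i ℤ.* j))                  ≈⟨ ℚ.toℚᵘ-fromℚᵘ (mkℚᵘ (i ℤ.* j) 0) ⟩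
  mkℚᵘ i 0 ℚᵘ.* mkℚᵘ j 0                    ≈⟨ ℚᵘ.*-cong (ℚ.toℚᵘ-fromℚᵘ (mkℚᵘ i 0)) (ℚ.toℚᵘ-fromℚᵘ (mkℚᵘ j 0)) ⟨
  ℚ.toℚᵘ (fromℤ i) ℚᵘ.* ℚ.toℚᵘ (fromℤ j)    ≈⟨ ℚ.toℚᵘ-homo-* (fromℤ i) (fromℤ j) ⟨
  ℚ.toℚᵘ (fromℤ i ℚ.* fromℤ j)              ∎)
  where open ℚᵘ.≃-Reasoning

÷-cancel-* : ∀ p q .{{_ : ℚ.NonZero q}} → p ℚ.÷ q ℚ.* q ≡ p
÷-cancel-* p q = begin
  p ℚ.* ℚ.1/ q ℚ.* q    ≡⟨ ℚ.*-assoc p (ℚ.1/ q) q ⟩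
  p ℚ.* (ℚ.1/ q ℚ.* q)  ≡⟨ cong (p ℚ.*_) (ℚ.*-inverseˡ q) ⟩
  p ℚ.* 1ℚ              ≡⟨ ℚ.*-identityʳ p ⟩
  p                     ∎
  where open ≡-Reasoning

*-cancel-÷ : ∀ p q .{{_ : ℚ.NonZero q}} → p ℚ.* q ℚ.÷ q ≡ p
*-cancel-÷ p q = begin
  p ℚ.* q ℚ.* ℚ.1/ q    ≡⟨ ℚ.*-assoc p q (ℚ.1/ q) ⟩
  p ℚ.* (q ℚ.* ℚ.1/ q)  ≡⟨ cong (p ℚ.*_) (ℚ.*-inverseʳ q) ⟩
  p ℚ.* 1ℚ              ≡⟨ ℚ.*-identityʳ p ⟩
  p                     ∎
  where open ≡-Reasoning

isIntegral⇒∣ : ∀ i j .{{_ : ℚ.NonZero (fromℤ j)}} →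
               IsIntegral (fromℤ i ℚ.÷ fromℤ j) → j ∣ i
isIntegral⇒∣ i j (k , eq) = divides k (fromℤ-injective (begin
  fromℤ i                          ≡⟨ ÷-cancel-* (fromℤ i) (fromℤ j) ⟨
  fromℤ i ℚ.÷ fromℤ j ℚ.* fromℤ j  ≡⟨ cong (ℚ._* fromℤ j) eq ⟩
  fromℤ k ℚ.* fromℤ j              ≡⟨ fromℤ-homo-* k j ⟨
  fromℤ (k ℤ.* j)                  ∎))
  where open ≡-Reasoning

∣⇒isIntegral : ∀ i j .{{_ : ℚ.NonZero (fromℤ j)}} →
               j ∣ i → IsIntegral (fromℤ i ℚ.÷ fromℤ j)
∣⇒isIntegral i j (divides k refl) = k , (begin
  fromℤ (k ℤ.* j) ℚ.÷ fromℤ j      ≡⟨ cong (λ p → p ℚ.÷ fromℤ j) (fromℤ-homo-* k j) ⟩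
  fromℤ k ℚ.* fromℤ j ℚ.÷ fromℤ j  ≡⟨ *-cancel-÷ (fromℤ k) (fromℤ j) ⟩
  fromℤ k                          ∎)
  where open ≡-Reasoning

i+j-i≡j : ∀ i j → i ℤ.+ j ℤ.- i ≡ j
i+j-i≡j = solve-∀

[m+n]-m≡n : ∀ m n → + (m ℕ.+ n) ℤ.- + m ≡ + n
[m+n]-m≡n m n = trans (cong (ℤ._- + m) (ℤ.pos-+ m n)) (i+j-i≡j (+ m) (+ n))

∣0 : ∀ {d} → d ∣ 0ℤ
∣0 = divides 0ℤ refl

∣i-i : ∀ {d} i → d ∣ i ℤ.- i
∣i-i {d} i = subst (d ∣_) (sym (ℤ.+-inverseʳ i)) ∣0

-- Divisibility depends only on absolute values, and these ignore the order of subtraction.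
∣-swap-minus : ∀ i j k l → i ℤ.- j ∣ k ℤ.- l → j ℤ.- i ∣ l ℤ.- k
∣-swap-minus i j k l i-j∣k-l = ∣ᵤ⇒∣
  (subst₂ ℕ._∣_ (ℤ.∣i-j∣≡∣j-i∣ i j) (ℤ.∣i-j∣≡∣j-i∣ k l) (∣⇒∣ᵤ i-j∣k-l))

-- Writing the two points as `x` and `x + n` makes the denominator `n`. The case `n = 0`, where no
-- ratio exists, holds because the difference vanishes.
ratios⇒∣ : ∀ f → HasIntegralDifferenceRatios f →
           ∀ x n → + n ∣ f (x ℕ.+ n) ℤ.- f x
ratios⇒∣ f _ x zero = subst (λ y → 0ℤ ∣ f y ℤ.- f x) (sym (ℕ.+-identityʳ x))
  (∣i-i (f x))
ratios⇒∣ f ratios x (suc n) = subst (_∣ f (x ℕ.+ suc n) ℤ.- f x) ([m+n]-m≡n x (suc n))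
  (isIntegral⇒∣ _ (+ (x ℕ.+ suc n) ℤ.- + x) {{fromℤ-nonZero x+n≢x}}
    (ratios (x ℕ.+ suc n) x x+n≢x))
  where
  x+n≢x : x ℕ.+ suc n ≢ x
  x+n≢x = ℕ.m+1+n≢m x

∣⇒ratios : ∀ f → (∀ x n → + n ∣ f (x ℕ.+ n) ℤ.- f x) →
           HasIntegralDifferenceRatios f
∣⇒ratios f step x y x≢y =
  ∣⇒isIntegral (f x ℤ.- f y) (+ x ℤ.- + y) {{fromℤ-nonZero x≢y}}
    -- By symmetry the smaller point may come first. `Q` subtracts its first argument from its
    -- second, hence the order `y x`.
    (wlog {Q = Q} ℕ.≤-total
      (λ {x} {y} → ∣-swap-minus (+ y) (+ x) (f y) (f x)) ordered y x)
  where
  Q : ℕ → ℕ → Set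
  Q x y = + y ℤ.- + x ∣ f y ℤ.- f x

  ordered : ∀ x y → x ℕ.≤ y → Q x y
  ordered x _ x≤y with n , refl ← ℕ.m≤n⇒∃[o]m+o≡n x≤y =
    subst (_∣ f (x ℕ.+ n) ℤ.- f x) (sym ([m+n]-m≡n x n)) (step x n)

-- Binomial coefficients

nC0≡1 : ∀ n → n C 0 ≡ 1
nC0≡1 n = trans (nCk≡nC[n∸k] {0} {n} ℕ.z≤n) (nCn≡1 n)

-- Induction on `n` through Pascal's rule.
absorption : ∀ n k → suc k ℕ.* (suc n C suc k) ≡ suc n ℕ.* (n C k)
absorption zero    zero    = refl
absorption zero    (suc k) = begin
  suc (suc k) ℕ.* (1 C suc (suc k))  ≡⟨ cong (suc (suc k) ℕ.*_) (k>n⇒nCk≡0 (s<s (ℕ.z<s {k}))) ⟩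
  suc (suc k) ℕ.* 0                  ≡⟨ ℕ.*-zeroʳ (suc (suc k)) ⟩
  0                                  ≡⟨ cong (1 ℕ.*_) (k>n⇒nCk≡0 (ℕ.z<s {k})) ⟨
  1 ℕ.* (0 C suc k)                  ∎
  where open ≡-Reasoning
absorption (suc n) zero    = begin
  1 ℕ.* (suc (suc n) C 1)                    ≡⟨ cong (1 ℕ.*_) (nCk+nC[k+1]≡[n+1]C[k+1] (suc n) 0) ⟨
  1 ℕ.* (suc n C 0 ℕ.+ suc n C 1)            ≡⟨ ℕ.*-distribˡ-+ 1 (suc n C 0) (suc n C 1) ⟩
  1 ℕ.* (suc n C 0) ℕ.+ 1 ℕ.* (suc n C 1)    ≡⟨ cong (1 ℕ.* (suc n C 0) ℕ.+_) (absorption n 0) ⟩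
  1 ℕ.* (suc n C 0) ℕ.+ suc n ℕ.* (n C 0)    ≡⟨ cong (λ c → 1 ℕ.* (suc n C 0) ℕ.+ suc n ℕ.* c) (trans (nC0≡1 n) (sym (nC0≡1 (suc n)))) ⟩
  1 ℕ.* (suc n C 0) ℕ.+ suc n ℕ.* (suc n C 0) ≡⟨ ℕ.*-distribʳ-+ (suc n C 0) 1 (suc n) ⟨
  suc (suc n) ℕ.* (suc n C 0)                ∎
  where open ≡-Reasoning
absorption (suc n) (suc k) = begin
  suc (suc k) ℕ.* (suc (suc n) C suc (suc k))
    ≡⟨ cong (suc (suc k) ℕ.*_) (nCk+nC[k+1]≡[n+1]C[k+1] (suc n) (suc k)) ⟨
  suc (suc k) ℕ.* (c ℕ.+ suc n C suc (suc k))
    -- Setting one copy of `c` aside leaves exactly the factors of the induction hypotheses at `k`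
    -- and `suc k`; Pascal's rule then reassembles `suc n` further copies of `c`.
    ≡⟨ split k c (suc n C suc (suc k)) ⟩
  c ℕ.+ (suc k ℕ.* c ℕ.+ suc (suc k) ℕ.* (suc n C suc (suc k)))
    ≡⟨ cong₂ (λ s t → c ℕ.+ (s ℕ.+ t)) (absorption n k) (absorption n (suc k)) ⟩
  c ℕ.+ (suc n ℕ.* (n C k) ℕ.+ suc n ℕ.* (n C suc k))
    ≡⟨ cong (c ℕ.+_) (ℕ.*-distribˡ-+ (suc n) (n C k) (n C suc k)) ⟨
  c ℕ.+ suc n ℕ.* (n C k ℕ.+ n C suc k)
    ≡⟨ cong (λ d → c ℕ.+ suc n ℕ.* d) (nCk+nC[k+1]≡[n+1]C[k+1] n k) ⟩
  suc (suc n) ℕ.* c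
    ∎
  where
  open ≡-Reasoning
  c = suc n C suc k
  split : ∀ k c d → suc (suc k) ℕ.* (c ℕ.+ d) ≡ c ℕ.+ (suc k ℕ.* c ℕ.+ suc (suc k) ℕ.* d)
  split = ℕ-Solver.solve-∀

-- Absorption trades the factor `suc k` of `i` for `suc n`, leaving `n C k` in the quotient.
∣⇒∣*C : ∀ n k {i} → + suc k ∣ i → + suc n ∣ i ℤ.* + (suc n C suc k)
∣⇒∣*C n k (divides q refl) = divides (q ℤ.* + (n C k)) (begin
  q ℤ.* + suc k ℤ.* + (suc n C suc k)    ≡⟨ ℤ.*-assoc q (+ suc k) (+ (suc n C suc k)) ⟩
  q ℤ.* (+ suc k ℤ.* + (suc n C suc k))  ≡⟨ cong (q ℤ.*_) (ℤ.pos-* (suc k) (suc n C suc k)) ⟨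
  q ℤ.* + (suc k ℕ.* (suc n C suc k))    ≡⟨ cong (λ m → q ℤ.* + m) (trans (absorption n k) (ℕ.*-comm (suc n) (n C k))) ⟩
  q ℤ.* + ((n C k) ℕ.* suc n)            ≡⟨ cong (q ℤ.*_) (ℤ.pos-* (n C k) (suc n)) ⟩
  q ℤ.* (+ (n C k) ℤ.* + suc n)          ≡⟨ ℤ.*-assoc q (+ (n C k)) (+ suc n) ⟨
  q ℤ.* + (n C k) ℤ.* + suc n            ∎)
  where open ≡-Reasoning

-- Newton series

E : (ℕ → ℤ) → ℕ → ℤ
E a k = a k ℤ.+ a (suc k)

newton-0 : ∀ a → newton a 0 ≡ a 0
newton-0 a = trans (ℤ.+-identityʳ (a 0 ℤ.* + 1)) (ℤ.*-identityʳ (a 0))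

newton-tail : (ℕ → ℤ) → ∀ n → Fin (suc n) → ℤ
newton-tail a n k = a (suc (toℕ k)) ℤ.* + (suc n C suc (toℕ k))

newton-suc : ∀ a n → newton a (suc n) ≡ newton a 0 ℤ.+ sum (newton-tail a n)
newton-suc a n = cong (ℤ._+ sum (newton-tail a n)) (begin
  a 0 ℤ.* + (suc n C 0)  ≡⟨ cong (λ c → a 0 ℤ.* + c) (nC0≡1 (suc n)) ⟩
  a 0 ℤ.* + 1            ≡⟨ ℤ.*-identityʳ (a 0) ⟩
  a 0                    ≡⟨ newton-0 a ⟨
  newton a 0             ∎)
  where open ≡-Reasoning

-- The top binomial coefficient is 1, so the last term is the bare coefficient, which the induction
-- in `differences⇒coefficients` solves for.
newton-tail-last : ∀ a n → sum (newton-tail a n) ≡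
                   sum (newton-tail a n ∘ inject₁) ℤ.+ a (suc n)
newton-tail-last a n = trans (sum-init-last (newton-tail a n))
  (cong (λ i → sum (newton-tail a n ∘ inject₁) ℤ.+ i) (begin
    newton-tail a n (fromℕ n)          ≡⟨ cong (λ m → a (suc m) ℤ.* + (suc n C suc m)) (toℕ-fromℕ n) ⟩
    a (suc n) ℤ.* + (suc n C suc n)    ≡⟨ cong (λ c → a (suc n) ℤ.* + c) (nCn≡1 (suc n)) ⟩
    a (suc n) ℤ.* + 1                  ≡⟨ ℤ.*-identityʳ (a (suc n)) ⟩
    a (suc n)                          ∎))
  where open ≡-Reasoning

-- The extra term carries `n C suc n`, which is 0.
newton-extend : ∀ a n → ∑[ k ≤ suc n ] (a (toℕ k) ℤ.* + (n C toℕ k)) ≡ newton a n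
newton-extend a n = begin
  ∑[ k ≤ suc n ] t (toℕ k)                            ≡⟨ sum-init-last (t ∘ toℕ) ⟩
  ∑[ k ≤ n ] t (toℕ (inject₁ k)) ℤ.+ t (toℕ (fromℕ (suc n)))
    ≡⟨ cong₂ ℤ._+_ (sum-cong-≗ {suc n} (cong t ∘ toℕ-inject₁)) (cong t (toℕ-fromℕ (suc n))) ⟩
  newton a n ℤ.+ a (suc n) ℤ.* + (n C suc n)
    ≡⟨ cong (λ c → newton a n ℤ.+ a (suc n) ℤ.* + c) (k>n⇒nCk≡0 (ℕ.n<1+n n)) ⟩
  newton a n ℤ.+ a (suc n) ℤ.* 0ℤ                     ≡⟨ cong (λ i → newton a n ℤ.+ i) (ℤ.*-zeroʳ (a (suc n))) ⟩
  newton a n ℤ.+ 0ℤ                                   ≡⟨ ℤ.+-identityʳ (newton a n) ⟩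
  newton a n                                          ∎
  where
  open ≡-Reasoning
  t : ℕ → ℤ
  t k = a k ℤ.* + (n C k)

-- Pascal's rule splits the series into those of `a` and of `a ∘ suc`, whose sum is the series of
-- `E a`.
newton-E : ∀ a n → newton a (suc n) ≡ newton (E a) n
newton-E a n = begin
  a 0 ℤ.* + (suc n C 0) ℤ.+ sum (newton-tail a n)
    ≡⟨ cong₂ ℤ._+_ (cong (λ c → a 0 ℤ.* + c) (trans (nC0≡1 (suc n)) (sym (nC0≡1 n))))
                   (sum-cong-≗ {suc n} (pascal ∘ toℕ)) ⟩
  t 0 ℤ.+ ∑[ k ≤ n ] (u (toℕ k) ℤ.+ t (suc (toℕ k)))
    ≡⟨ cong (λ i → t 0 ℤ.+ i) (∑-distrib-+ {suc n} (u ∘ toℕ) (t ∘ suc ∘ toℕ)) ⟩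
  t 0 ℤ.+ (newton (a ∘ suc) n ℤ.+ ∑[ k ≤ n ] t (suc (toℕ k)))
    -- The constant term rejoins the terms of positive index, giving a sum that runs one index past
    -- `n`.
    ≡⟨ swap (t 0) _ _ ⟩
  ∑[ k ≤ suc n ] t (toℕ k) ℤ.+ newton (a ∘ suc) n
    ≡⟨ cong (ℤ._+ newton (a ∘ suc) n) (newton-extend a n) ⟩
  newton a n ℤ.+ newton (a ∘ suc) n
    ≡⟨ ∑-distrib-+ {suc n} (t ∘ toℕ) (u ∘ toℕ) ⟨
  ∑[ k ≤ n ] (t (toℕ k) ℤ.+ u (toℕ k))
    ≡⟨ sum-cong-≗ {suc n} (λ k → sym (ℤ.*-distribʳ-+ (+ (n C toℕ k)) (a (toℕ k)) (a (suc (toℕ k))))) ⟩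
  newton (E a) n
    ∎
  where
  open ≡-Reasoning
  t u : ℕ → ℤ
  t k = a k ℤ.* + (n C k)
  u k = a (suc k) ℤ.* + (n C k)

  pascal : ∀ k → a (suc k) ℤ.* + (suc n C suc k) ≡ u k ℤ.+ t (suc k)
  pascal k = begin
    a (suc k) ℤ.* + (suc n C suc k)            ≡⟨ cong (λ c → a (suc k) ℤ.* + c) (nCk+nC[k+1]≡[n+1]C[k+1] n k) ⟨
    a (suc k) ℤ.* + (n C k ℕ.+ n C suc k)      ≡⟨ cong (a (suc k) ℤ.*_) (ℤ.pos-+ (n C k) (n C suc k)) ⟩
    a (suc k) ℤ.* (+ (n C k) ℤ.+ + (n C suc k)) ≡⟨ ℤ.*-distribˡ-+ (a (suc k)) (+ (n C k)) (+ (n C suc k)) ⟩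
    u k ℤ.+ t (suc k)                          ∎

  swap : ∀ i j k → i ℤ.+ (j ℤ.+ k) ≡ i ℤ.+ k ℤ.+ j
  swap = solve-∀

-- `fold a E x` is Eˣ a. Each step hands one unit from `x` to `n`, where `newton-E` turns it into an
-- application of `E`.
newton-shift : ∀ a x n → newton a (x ℕ.+ n) ≡ newton (fold a E x) n
newton-shift a zero    n = refl
newton-shift a (suc x) n = begin
  newton a (suc x ℕ.+ n)        ≡⟨ cong (newton a) (ℕ.+-suc x n) ⟨
  newton a (x ℕ.+ suc n)        ≡⟨ newton-shift a x (suc n) ⟩
  newton (fold a E x) (suc n)   ≡⟨ newton-E (fold a E x) n ⟩
  newton (fold a E (suc x)) n   ∎
  where open ≡-Reasoning

-- This moves the base point to 0, so that divisibility need only be studied there, for every Eˣ a.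
newton-difference : ∀ a x n → newton a (x ℕ.+ n) ℤ.- newton a x ≡
                    newton (fold a E x) n ℤ.- newton (fold a E x) 0
newton-difference a x n = cong₂ ℤ._-_ (newton-shift a x n)
  (trans (cong (newton a) (sym (ℕ.+-identityʳ x))) (newton-shift a x 0))

-- Divisibility of Newton coefficients

∣-sum : ∀ {d n} (t : Fin n → ℤ) → (∀ k → d ∣ t k) → d ∣ sum t
∣-sum {d} {zero}  t d∣t = ∣0
∣-sum {d} {suc n} t d∣t = ∣m∣n⇒∣m+n (d∣t zero) (∣-sum (t ∘ suc) (d∣t ∘ suc))

newton-suc-0 : ∀ a n → newton a (suc n) ℤ.- newton a 0 ≡ sum (newton-tail a n)
newton-suc-0 a n = trans (cong (ℤ._- newton a 0) (newton-suc a n)) (i+j-i≡j (newton a 0) _)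

coefficients⇒differences : ∀ a → (∀ k → + suc k ∣ a (suc k)) →
                           ∀ n → + n ∣ newton a n ℤ.- newton a 0
coefficients⇒differences a k∣a zero    = ∣i-i (newton a 0)
coefficients⇒differences a k∣a (suc n) = subst (+ suc n ∣_) (sym (newton-suc-0 a n))
  (∣-sum (newton-tail a n) (λ k → ∣⇒∣*C n (toℕ k) (k∣a (toℕ k))))

-- Strong induction: `suc n` divides the whole tail and, by the earlier cases with absorption, every
-- term but the last; hence it divides the last.
differences⇒coefficients : ∀ a → (∀ n → + n ∣ newton a n ℤ.- newton a 0) →
                           ∀ k → + suc k ∣ a (suc k)
differences⇒coefficients a n∣Δ = <-rec (λ k → + suc k ∣ a (suc k)) λ n rec →
  ∣m+n∣m⇒∣n
    (subst (+ suc n ∣_) (trans (newton-suc-0 a n) (newton-tail-last a n)) (n∣Δ (suc n)))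
    (∣-sum (newton-tail a n ∘ inject₁) λ k → ∣⇒∣*C n (toℕ (inject₁ k))
      (rec (subst (ℕ._< n) (sym (toℕ-inject₁ k)) (toℕ<n k))))

-- Raising the index by one costs one more application of `E`, so the divisibility is carried for
-- all `x` at once.
fold-E-∣ : ∀ {a d k} → (∀ x → d ∣ fold a E x k) → ∀ m x → d ∣ fold a E x (m ℕ.+ k)
fold-E-∣ d∣ zero    x = d∣ x
fold-E-∣ d∣ (suc m) x = ∣m+n∣m⇒∣n (fold-E-∣ d∣ m (suc x)) (fold-E-∣ d∣ m x)

-- Least common multiples

lcm∣lcm-suc : ∀ k → lcm k ℕ.∣ lcm (suc k)
lcm∣lcm-suc k = LCM.n∣lcm[m,n] (suc k) (lcm k)

suc∣lcm-suc : ∀ k → suc k ℕ.∣ lcm (suc k)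
suc∣lcm-suc k = LCM.m∣lcm[m,n] (suc k) (lcm k)

lcm-least : ∀ k {m} → (∀ j → j ℕ.< k → suc j ℕ.∣ m) → lcm k ℕ.∣ m
lcm-least zero    j∣m = ℕ.1∣ _
lcm-least (suc k) j∣m = LCM.lcm-least (j∣m k (ℕ.n<1+n k))
  (lcm-least k (λ j j<k → j∣m j (ℕ.m<n⇒m<1+n j<k)))

-- `E` adds entries `k` and `suc k`, and `lcm k` divides the latter through `lcm (suc k)`.
lcm∣-fold-E : ∀ {a} → (∀ k → + lcm k ∣ a k) → ∀ x k → + lcm k ∣ fold a E x k
lcm∣-fold-E lcm∣a zero    k = lcm∣a k
lcm∣-fold-E lcm∣a (suc x) k = ∣m∣n⇒∣m+n (lcm∣-fold-E lcm∣a x k)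
  (∣-trans (∣ᵤ⇒∣ (lcm∣lcm-suc k)) (lcm∣-fold-E lcm∣a x (suc k)))

differences⇒lcm : ∀ a → (∀ x n → + n ∣ newton a (x ℕ.+ n) ℤ.- newton a x) →
                  ∀ k → + lcm k ∣ a k
differences⇒lcm a n∣Δ k = ∣ᵤ⇒∣ (lcm-least k λ j j<k → ∣⇒∣ᵤ
  -- Divisibility by `suc j` is known at index `suc j` for every Eˣ a; it climbs `k ∸ suc j` places
  -- to index `k`, and `x = 0` gives `a` itself.
  (subst (λ i → + suc j ∣ a i) (ℕ.m∸n+n≡m j<k)
    (fold-E-∣ (λ x → suc∣ x j) (k ℕ.∸ suc j) 0)))
  where
  suc∣ : ∀ x k → + suc k ∣ fold a E x (suc k)
  suc∣ x = differences⇒coefficients (fold a E x)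
    λ n → subst (+ n ∣_) (newton-difference a x n) (n∣Δ x n)

lcm⇒differences : ∀ a → (∀ k → + lcm k ∣ a k) →
                  ∀ x n → + n ∣ newton a (x ℕ.+ n) ℤ.- newton a x
lcm⇒differences a lcm∣a x n = subst (+ n ∣_) (sym (newton-difference a x n))
  (coefficients⇒differences (fold a E x)
    (λ k → ∣-trans (∣ᵤ⇒∣ (suc∣lcm-suc k)) (lcm∣-fold-E lcm∣a x (suc k))) n)

theorem2p5 : (f : ℕ → ℤ) (a : ℕ → ℤ) →
    (∀ x → f x ≡ newton a x) →
    HasIntegralDifferenceRatios f ⇔ (∀ k → + (lcm k) ∣ a k)
theorem2p5 f a f≡ = mk⇔
  (λ ratios → differences⇒lcm a
    λ x n → subst (+ n ∣_) (f-f≡ x n) (ratios⇒∣ f ratios x n))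
  (λ lcm∣a → ∣⇒ratios f
    λ x n → subst (+ n ∣_) (sym (f-f≡ x n)) (lcm⇒differences a lcm∣a x n))
  where
  f-f≡ : ∀ x n → f (x ℕ.+ n) ℤ.- f x ≡ newton a (x ℕ.+ n) ℤ.- newton a x
  f-f≡ x n = cong₂ ℤ._-_ (f≡ (x ℕ.+ n)) (f≡ x)
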